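{- For each integer $n\geq 0$, let $f_n$ denote the number of isomorphism classes of matroids on a set of size $n$. Then $f_{n+m}\geq f_n\cdot f_m$ for all integers $n,m\geq 0$.
   Context: Two matroids are isomorphic if there is a bijection between their ground sets carrying independent sets exactly to independent sets. -}

module Defs where

open import Data.Bool.Base using (Bool; true; false; T; if_then_else_)
open import Data.Bool.Properties using (T?)
open import Data.Fin.Base using (Fin; zero; suc; punchIn)
open import Data.Fin.Permutation as Perm
  using (Permutation; _⟨$⟩ʳ_; _⟨$⟩ˡ_; inverseˡ; inverseʳ; _∘ₚ_; flip; insert; remove; insert-remove)
open import Data.Fin.Properties using (any?)
open import Data.Fin.Subset using (Subset; ⊥; ⁅_⁆; _∪_; _∈_; _∉_; _⊆_; ∣_∣)
open import Data.Fin.Subset.Properties using (_∈?_; _⊆?_; anySubset?)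
open import Data.List.Base
  using (List; []; _∷_; length; lookup; deduplicate; mapMaybe; cartesianProductWith; allFin)
open import Data.List.Membership.Propositional.Properties using (∈-allFin; ∈-lookup)
import Data.List.Relation.Unary.Any as Any
open Any using (Any; here; there)
import Data.List.Relation.Unary.Any.Properties as Anyₚ
open import Data.List.Relation.Unary.Enumerates.Setoid using (IsEnumeration)
open import Data.List.Relation.Unary.Enumerates.Setoid.Properties
  using (deduplicate⁺; lookup-surjective)
import Data.List.Relation.Unary.Unique.Setoid as Unique
import Data.List.Relation.Unary.All as All
open import Data.List.Relation.Unary.Unique.DecSetoid.Properties using (deduplicate-!)
open import Data.Maybe.Base using (Maybe; just; nothing)
import Data.Maybe.Relation.Unary.Any as MAny
open import Data.Nat.Base using (ℕ; zero; suc; _<_)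
open import Data.Nat.Properties using (_<?_)
open import Data.Product.Base using (Σ-syntax; ∃-syntax; _×_; _,_; proj₁; proj₂)
open import Data.Vec.Base as Vec using ([]; _∷_; tabulate)
open import Data.Vec.Properties using (lookup∘tabulate; tabulate-cong; tabulate∘lookup)
open import Function.Base using (_∘_)
open import Function.Bundles using (Bijection; Equivalence; _⇔_; mk⇔)
open import Level as Level using (0ℓ)
open import Relation.Binary.Bundles using (Setoid; DecSetoid)
open import Relation.Binary.PropositionalEquality
  using (_≡_; refl; sym; trans; cong; subst; setoid)
open import Relation.Nullary.Decidable
  using (Dec; yes; no; ⌊_⌋; map′; ¬?; _×-dec_; _→-dec_; decidable-stable; toWitness; fromWitness)
open import Relation.Nullary.Negation using (contradiction)
open import Relation.Unary using (Pred; Decidable)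

private
  variable
    m n o : ℕ

record IsMatroid (Indep : Pred (Subset n) 0ℓ) : Set where
  field
    empty        : Indep ⊥
    hereditary   : ∀ I J → J ⊆ I → Indep I → Indep J
    augmentation : ∀ I J → Indep I → Indep J → ∣ I ∣ < ∣ J ∣ →
                   ∃[ x ] (x ∈ J × x ∉ I × Indep (⁅ x ⁆ ∪ I))

-- A collection of subsets of a finite set is itself a finite object, so
-- constructively its membership predicate has to be decidable.
record Matroid (n : ℕ) : Set₁ where
  field
    Indep     : Pred (Subset n) 0ℓ
    indep?    : Decidable Indep
    isMatroid : IsMatroid Indep

  open IsMatroid isMatroid public

open Matroid using (Indep; indep?; isMatroid)

-- j belongs to the image of I exactly when π⁻¹ j belongs to I.
image : Permutation m n → Subset m → Subset n
image π I = tabulate λ j → Vec.lookup I (π ⟨$⟩ˡ j)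

infix 4 _≅_

_≅_ : Matroid m → Matroid n → Set
_≅_ {m} {n} M N = Σ[ π ∈ Permutation m n ] (∀ I → Indep M I ⇔ Indep N (image π I))

private
  open Equivalence using (to; from)

  image-id : (I : Subset n) → image Perm.id I ≡ I
  image-id = tabulate∘lookup

  image-∘ : (π : Permutation m n) (ρ : Permutation n o) (I : Subset m) →
            image (π ∘ₚ ρ) I ≡ image ρ (image π I)
  image-∘ π ρ I = tabulate-cong λ j → sym (lookup∘tabulate _ (ρ ⟨$⟩ˡ j))

  image-flip : (π : Permutation m n) (J : Subset n) → image π (image (flip π) J) ≡ J
  image-flip π J = trans
    (tabulate-cong λ j → trans (lookup∘tabulate _ (π ⟨$⟩ˡ j)) (cong (Vec.lookup J) (inverseʳ π)))
    (tabulate∘lookup J)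

  image-cong : (π ρ : Permutation m n) → π Perm.≈ ρ → (I : Subset m) → image π I ≡ image ρ I
  image-cong π ρ π≈ρ I = tabulate-cong λ j → cong (Vec.lookup I)
    (trans (cong (π ⟨$⟩ˡ_) (sym (trans (π≈ρ _) (inverseʳ ρ)))) (inverseˡ π))

≅-refl : {M : Matroid n} → M ≅ M
≅-refl {M = M} = Perm.id , λ I →
  mk⇔ (subst (Indep M) (sym (image-id I))) (subst (Indep M) (image-id I))

≅-sym : {M : Matroid m} {N : Matroid n} → M ≅ N → N ≅ M
≅-sym {N = N} (π , h) = flip π , λ J → mk⇔
  (λ p → from (h _) (subst (Indep N) (sym (image-flip π J)) p))
  (λ p → subst (Indep N) (image-flip π J) (to (h _) p))

≅-trans : {M : Matroid m} {N : Matroid n} {P : Matroid o} → M ≅ N → N ≅ P → M ≅ P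
≅-trans {P = P} (π , h) (ρ , k) = π ∘ₚ ρ , λ I → mk⇔
  (λ p → subst (Indep P) (sym (image-∘ π ρ I)) (to (k _) (to (h I) p)))
  (λ p → from (h I) (from (k _) (subst (Indep P) (image-∘ π ρ I) p)))

≅-setoid : ℕ → Setoid (Level.suc 0ℓ) 0ℓ
≅-setoid n = record
  { Carrier       = Matroid n
  ; _≈_           = _≅_
  ; isEquivalence = record
    { refl  = λ {M} → ≅-refl {M = M}
    ; sym   = λ {M} {N} → ≅-sym {M = M} {N}
    ; trans = λ {M} {N} {P} → ≅-trans {M = M} {N} {P}
    }
  }

allSubsets? : {P : Pred (Subset n) 0ℓ} → Decidable P → Dec (∀ I → P I)
allSubsets? P? = map′
  (λ ¬∃¬P I → decidable-stable (P? I) λ ¬PI → ¬∃¬P (I , ¬PI))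
  (λ ∀P (I , ¬PI) → ¬PI (∀P I))
  (¬? (anySubset? (¬? ∘ P?)))

permutations : ∀ m n → List (Permutation m n)
permutations zero    zero    = Perm.id ∷ []
permutations zero    (suc n) = []
permutations (suc m) zero    = []
permutations (suc m) (suc n) =
  cartesianProductWith (insert zero) (allFin (suc n)) (permutations m n)

permutations-complete : (π : Permutation m n) → Any (π Perm.≈_) (permutations m n)
permutations-complete {zero}  {zero}  π = here λ ()
permutations-complete {zero}  {suc n} π with () ← π ⟨$⟩ˡ zero
permutations-complete {suc m} {zero}  π with () ← π ⟨$⟩ʳ zero
permutations-complete {suc m} {suc n} π =
  Anyₚ.cartesianProductWith⁺ (insert zero) (λ { {j} {ρ} refl π′≈ρ i →
      trans (sym (insert-remove zero π i)) (insert-cong j (remove zero π) ρ π′≈ρ i) })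
    (∈-allFin (π ⟨$⟩ʳ zero)) (permutations-complete (remove zero π))
  where
  insert-cong : (j : Fin (suc n)) (σ ρ : Permutation m n) → σ Perm.≈ ρ →
                insert zero j σ Perm.≈ insert zero j ρ
  insert-cong j σ ρ σ≈ρ zero    = refl
  insert-cong j σ ρ σ≈ρ (suc i) = cong (punchIn j) (σ≈ρ i)

infix 4 _≅?_

_≅?_ : (M : Matroid m) (N : Matroid n) → Dec (M ≅ N)
_≅?_ {m} {n} M N = map′ Any.satisfied complete (Any.any? preserves? (permutations m n))
  where
  Preserves : Permutation m n → Set
  Preserves π = ∀ I → Indep M I ⇔ Indep N (image π I)

  preserves? : Decidable Preserves
  preserves? π = allSubsets? λ I → map′ (λ (p , q) → mk⇔ p q) (λ e → to e , from e)
    ((indep? M I →-dec indep? N (image π I)) ×-dec (indep? N (image π I) →-dec indep? M I))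

  complete : M ≅ N → Any Preserves (permutations m n)
  complete (π , h) = Any.map
    (λ {ρ} π≈ρ I → subst (λ J → Indep M I ⇔ Indep N J) (image-cong π ρ π≈ρ I) (h I))
    (permutations-complete π)

≅-decSetoid : ℕ → DecSetoid (Level.suc 0ℓ) 0ℓ
≅-decSetoid n = record
  { Carrier          = Matroid n
  ; _≈_              = _≅_
  ; isDecEquivalence = record
    { isEquivalence = Setoid.isEquivalence (≅-setoid n)
    ; _≟_           = _≅?_
    }
  }

Family : ℕ → Set
Family n = Subset n → Bool

private
  ⟦_⟧ : Family n → Pred (Subset n) 0ℓ
  ⟦ F ⟧ I = T (F I)

  branch : Family n → Family n → Family (suc n)
  branch F G (b ∷ I) = if b then F I else G I

families : ∀ n → List (Family n)
families zero    = (λ _ → true) ∷ (λ _ → false) ∷ []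
families (suc n) = cartesianProductWith branch (families n) (families n)

families-complete : (F : Family n) → Any (λ G → ∀ I → F I ≡ G I) (families n)
families-complete {zero} F with F [] in eq
... | true  = here λ { [] → eq }
... | false = there (here λ { [] → eq })
families-complete {suc n} F = Anyₚ.cartesianProductWith⁺ branch
  (λ { p q (true ∷ I) → p I ; p q (false ∷ I) → q I })
  (families-complete (F ∘ (true ∷_))) (families-complete (F ∘ (false ∷_)))

isMatroid? : (F : Family n) → Dec (IsMatroid ⟦ F ⟧)
isMatroid? F = map′
  (λ (e , h , a) → record { empty = e ; hereditary = h ; augmentation = a })
  (λ M → let open IsMatroid M in empty , hereditary , augmentation)
  ( F? ⊥
  ×-dec (allSubsets? λ I → allSubsets? λ J → J ⊆? I →-dec F? I →-dec F? J)
  ×-dec (allSubsets? λ I → allSubsets? λ J →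
           F? I →-dec F? J →-dec ∣ I ∣ <? ∣ J ∣ →-dec
           any? λ x → x ∈? J ×-dec ¬? (x ∈? I) ×-dec F? (⁅ x ⁆ ∪ I)))
  where
  F? : Decidable ⟦ F ⟧
  F? I = T? (F I)

toMatroid : Family n → Maybe (Matroid n)
toMatroid F with isMatroid? F
... | yes p = just (record { Indep = ⟦ F ⟧ ; indep? = λ I → T? (F I) ; isMatroid = p })
... | no  _ = nothing

matroids : ∀ n → List (Matroid n)
matroids n = mapMaybe toMatroid (families n)

matroids-complete : IsEnumeration (≅-setoid n) (matroids n)
matroids-complete {n} M = Anyₚ.mapMaybe⁺ toMatroid (families n)
  (Anyₚ.map⁺ (Any.map found (families-complete (λ I → ⌊ indep? M I ⌋))))
  where
  module _ {F : Family n} (eq : ∀ I → ⌊ indep? M I ⌋ ≡ F I) where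
    sound : ∀ {I} → Indep M I → ⟦ F ⟧ I
    sound {I} p = subst T (eq I) (fromWitness {a? = indep? M I} p)

    unsound : ∀ {I} → ⟦ F ⟧ I → Indep M I
    unsound {I} p = toWitness {a? = indep? M I} (subst T (sym (eq I)) p)

    F-isMatroid : IsMatroid ⟦ F ⟧
    F-isMatroid = record
      { empty        = sound M.empty
      ; hereditary   = λ I J J⊆I p → sound (M.hereditary I J J⊆I (unsound p))
      ; augmentation = λ I J p q I<J →
          let x , x∈J , x∉I , r = M.augmentation I J (unsound p) (unsound q) I<J
          in x , x∈J , x∉I , sound r
      }
      where module M = Matroid M

    found : MAny.Any (M ≅_) (toMatroid F)
    found with isMatroid? F
    ... | yes _ = MAny.just (Perm.id , λ I → mk⇔
            (λ p → subst ⟦ F ⟧ (sym (image-id I)) (sound p))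
            (λ p → unsound (subst ⟦ F ⟧ (image-id I) p)))
    ... | no ¬p = contradiction F-isMatroid ¬p

representatives : ∀ n → List (Matroid n)
representatives n = deduplicate _≅?_ (matroids n)

-- That this is the number of isomorphism classes is f-counts-classes.
f : ℕ → ℕ
f n = length (representatives n)

f-counts-classes : ∀ n → Bijection (setoid (Fin (f n))) (≅-setoid n)
f-counts-classes n = record
  { to        = lookup (representatives n)
  ; cong      = λ { {i} refl → ≅-refl {M = lookup (representatives n) i} }
  ; bijective = injective (deduplicate-! (≅-decSetoid n) (matroids n))
              , lookup-surjective (≅-setoid n)
                  (deduplicate⁺ (≅-decSetoid n) (matroids-complete {n}))
  }
  where
  open Unique (≅-setoid n) using (Unique; []; _∷_)

  injective : ∀ {Ms} → Unique Ms → ∀ {i j} → lookup Ms i ≅ lookup Ms j → i ≡ j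
  injective (_  ∷ _)      {zero}  {zero}  _   = refl
  injective (M≇ ∷ _)      {zero}  {suc j} M≅N =
    contradiction M≅N (All.lookup M≇ (∈-lookup j))
  injective {M ∷ Ms} (M≇ ∷ _) {suc i} {zero} N≅M =
    contradiction (≅-sym {M = lookup Ms i} {M} N≅M) (All.lookup M≇ (∈-lookup i))
  injective (_  ∷ unique) {suc i} {suc j} M≅N = cong suc (injective unique M≅N)

{-# OPTIONS --safe #-}

-- The free product M □ N (Crapo–Schmitt) on S ⊔ T has A ⊔ B independent iff A is independent in M
-- and ∣A∣ + ∣B∣ ≤ rank M + rank_N B.  It is the freest way to put N on top of M: exchanging an
-- element of S for one of T never destroys independence.  Suppose an isomorphism π : M □ N ≅ P □ Q
-- moves some x ∈ S out of the left block; by counting, it moves some y ∈ T into it.  Exchanging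
-- x for y preserves independence by the remark above for M □ N, and y for x by the remark for
-- P □ Q, so the transposition (x y) is an automorphism of M □ N and precomposing with it
-- repairs π at x.  Hence π may be taken block-preserving, which forces M ≅ P and N ≅ Q: the
-- free product is injective on pairs of isomorphism classes.

module Submission where

open import Defs
open import Data.Nat using (ℕ; _+_; _*_; _≥_)

open import Data.Fin.Base
  using (Fin; zero; suc; fromℕ<; toℕ; _↑ˡ_; _↑ʳ_; splitAt; punchOut; remQuot; combine)
open import Data.Fin.Permutation
  using (Permutation; permutation; _⟨$⟩ʳ_; _⟨$⟩ˡ_; inverseˡ; inverseʳ; flip; transpose)
import Data.Fin.Permutation.Components as PC
open import Data.Fin.Properties
  using (any?; ↑ˡ-injective; ↑ʳ-injective; splitAt-↑ˡ; splitAt-↑ʳ; join-splitAt; toℕ<n; fromℕ<-toℕ;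
         toℕ-fromℕ<; punchOut-injective; combine-remQuot; injective⇒≤)
  renaming (_≟_ to _≟ᶠ_)
open import Data.Fin.Subset
  using (Subset; ⊥; ⁅_⁆; _∪_; _∩_; _∈_; _∉_; _⊆_; ∣_∣; Side; inside; outside)
open import Data.Fin.Subset.Properties
  using (_∈?_; _⊆?_; anySubset?; ∪-identityˡ; p⊆q⇒∣p∣≤∣q∣; x∈p∪q⁻; x∈p∪q⁺; p∩q⊆p; p∩q⊆q; q⊆p∪q;
         ⊆-refl; ⊆-trans; x∈⁅y⁆⇒x≡y; x∈⁅x⁆; ∣p∣≤n; drop-∷-⊆)
open import Data.Nat.Base using (zero; suc; _<_; _≤_; s≤s)
open import Data.Nat.Properties
open import Data.Product.Base using (Σ-syntax; ∃-syntax; _×_; _,_; proj₁; proj₂; uncurry)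
open import Data.Sum.Base using (_⊎_; inj₁; inj₂)
open import Data.Vec.Base using ([]; _∷_; _++_; take; drop; lookup; _[_]≔_; here; there)
open import Data.Vec.Properties
  using (lookup∘tabulate; tabulate-cong; tabulate∘lookup; take++drop≡id; ++-injective;
         lookup-++ˡ; lookup-++ʳ; []≔-++-↑ˡ; []≔-++-↑ʳ; []≔-lookup; []≔-commutes;
         lookup∘update; lookup∘update′; []=⇒lookup; lookup⇒[]=)
open import Function.Base using (_∘_)
open import Function.Bundles using (Bijection; Equivalence; _⇔_; mk⇔)
open import Relation.Binary.PropositionalEquality
  using (_≡_; _≢_; refl; sym; trans; cong; cong₂; subst; subst₂; setoid; module ≡-Reasoning)
open import Relation.Nullary.Decidable using (Dec; yes; no; map′; ¬?; _×-dec_; decidable-stable)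
open import Relation.Nullary.Negation using (contradiction)

open Matroid using (Indep; indep?)
open Equivalence using (to; from)

private
  variable
    m n : ℕ

-- Arithmetic splittings and cardinalities of finite subsets

⟨$⟩ʳ-injective : (π : Permutation m n) {x y : Fin m} → π ⟨$⟩ʳ x ≡ π ⟨$⟩ʳ y → x ≡ y
⟨$⟩ʳ-injective π eq = trans (sym (inverseˡ π)) (trans (cong (π ⟨$⟩ˡ_) eq) (inverseˡ π))

+-<-split : ∀ {a b c d} → a + b < c + d → a < c ⊎ b < d
+-<-split {a} {b} {c} {d} lt with a <? c
... | yes a<c = inj₁ a<c
... | no  a≮c = inj₂ (≰⇒> λ d≤b → <⇒≱ lt (+-mono-≤ (≮⇒≥ a≮c) d≤b))

+-≤-split : ∀ {a b c d} → a + b ≤ c + d → a < c ⊎ b ≤ d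
+-≤-split {a} {b} {c} {d} le with a <? c
... | yes a<c = inj₁ a<c
... | no  a≮c = inj₂ (≮⇒≥ λ d<b → <⇒≱ (+-mono-≤-< (≮⇒≥ a≮c) d<b) le)

∣p∣+∣q∣≡∣p∪q∣+∣p∩q∣ : (p q : Subset n) → ∣ p ∣ + ∣ q ∣ ≡ ∣ p ∪ q ∣ + ∣ p ∩ q ∣
∣p∣+∣q∣≡∣p∪q∣+∣p∩q∣ []            []            = refl
∣p∣+∣q∣≡∣p∪q∣+∣p∩q∣ (outside ∷ p) (outside ∷ q) = ∣p∣+∣q∣≡∣p∪q∣+∣p∩q∣ p q
∣p∣+∣q∣≡∣p∪q∣+∣p∩q∣ (inside  ∷ p) (outside ∷ q) = cong suc (∣p∣+∣q∣≡∣p∪q∣+∣p∩q∣ p q)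
∣p∣+∣q∣≡∣p∪q∣+∣p∩q∣ (outside ∷ p) (inside  ∷ q) =
  trans (+-suc ∣ p ∣ ∣ q ∣) (cong suc (∣p∣+∣q∣≡∣p∪q∣+∣p∩q∣ p q))
∣p∣+∣q∣≡∣p∪q∣+∣p∩q∣ (inside  ∷ p) (inside  ∷ q) = cong suc (trans (+-suc ∣ p ∣ ∣ q ∣)
  (trans (cong suc (∣p∣+∣q∣≡∣p∪q∣+∣p∩q∣ p q)) (sym (+-suc ∣ p ∪ q ∣ ∣ p ∩ q ∣))))

∣p∣<∣q∣⇒∃∈q∉p : (p q : Subset n) → ∣ p ∣ < ∣ q ∣ → ∃[ x ] (x ∈ q × x ∉ p)
∣p∣<∣q∣⇒∃∈q∉p p q p<q with any? (λ x → x ∈? q ×-dec ¬? (x ∈? p))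
... | yes found = found
... | no  none  = contradiction
  (p⊆q⇒∣p∣≤∣q∣ λ {x} x∈q → decidable-stable (x ∈? p) λ x∉p → none (x , x∈q , x∉p)) (<⇒≱ p<q)

p⊆q∧∣q∣≤∣p∣⇒q⊆p : {p q : Subset n} → p ⊆ q → ∣ q ∣ ≤ ∣ p ∣ → q ⊆ p
p⊆q∧∣q∣≤∣p∣⇒q⊆p {p = []}          {[]}          _   _   ()
p⊆q∧∣q∣≤∣p∣⇒q⊆p {p = inside  ∷ p} {outside ∷ q} p⊆q _ _ with () ← p⊆q here
p⊆q∧∣q∣≤∣p∣⇒q⊆p {p = outside ∷ p} {inside  ∷ q} p⊆q q≤p _ =
  contradiction q≤p (<⇒≱ (s≤s (p⊆q⇒∣p∣≤∣q∣ (drop-∷-⊆ p⊆q))))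
p⊆q∧∣q∣≤∣p∣⇒q⊆p {p = inside  ∷ p} {inside  ∷ q} p⊆q q≤p here = here
p⊆q∧∣q∣≤∣p∣⇒q⊆p {p = inside  ∷ p} {inside  ∷ q} p⊆q (s≤s q≤p) (there x∈q) =
  there (p⊆q∧∣q∣≤∣p∣⇒q⊆p (drop-∷-⊆ p⊆q) q≤p x∈q)
p⊆q∧∣q∣≤∣p∣⇒q⊆p {p = outside ∷ p} {outside ∷ q} p⊆q q≤p (there x∈q) =
  there (p⊆q∧∣q∣≤∣p∣⇒q⊆p (drop-∷-⊆ p⊆q) q≤p x∈q)

⁅x⁆∪p≡p[x]≔inside : (x : Fin n) (p : Subset n) → ⁅ x ⁆ ∪ p ≡ p [ x ]≔ inside
⁅x⁆∪p≡p[x]≔inside zero    (_ ∷ p) = cong (inside ∷_) (∪-identityˡ p)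
⁅x⁆∪p≡p[x]≔inside (suc x) (b ∷ p) = cong (b ∷_) (⁅x⁆∪p≡p[x]≔inside x p)

∣⁅x⁆∪p∣≡1+∣p∣ : {x : Fin n} {p : Subset n} → x ∉ p → ∣ ⁅ x ⁆ ∪ p ∣ ≡ suc ∣ p ∣
∣⁅x⁆∪p∣≡1+∣p∣ {x = zero}  {inside  ∷ p} x∉p = contradiction here x∉p
∣⁅x⁆∪p∣≡1+∣p∣ {x = zero}  {outside ∷ p} x∉p = cong (λ q → suc ∣ q ∣) (∪-identityˡ p)
∣⁅x⁆∪p∣≡1+∣p∣ {x = suc x} {inside  ∷ p} x∉p = cong suc (∣⁅x⁆∪p∣≡1+∣p∣ (x∉p ∘ there))
∣⁅x⁆∪p∣≡1+∣p∣ {x = suc x} {outside ∷ p} x∉p = ∣⁅x⁆∪p∣≡1+∣p∣ (x∉p ∘ there)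

∣p∣≡1+∣p[x]≔outside∣ : {x : Fin n} {p : Subset n} → x ∈ p → ∣ p ∣ ≡ suc ∣ p [ x ]≔ outside ∣
∣p∣≡1+∣p[x]≔outside∣ here = refl
∣p∣≡1+∣p[x]≔outside∣ {p = inside  ∷ p} (there x∈p) = cong suc (∣p∣≡1+∣p[x]≔outside∣ x∈p)
∣p∣≡1+∣p[x]≔outside∣ {p = outside ∷ p} (there x∈p) = ∣p∣≡1+∣p[x]≔outside∣ x∈p

p[x]≔outside⊆p : (x : Fin n) (p : Subset n) → p [ x ]≔ outside ⊆ p
p[x]≔outside⊆p zero    (_ ∷ p) (there y∈p) = there y∈p
p[x]≔outside⊆p (suc x) (_ ∷ p) here        = here
p[x]≔outside⊆p (suc x) (_ ∷ p) (there y∈p) = there (p[x]≔outside⊆p x p y∈p)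

⁅x⁆∪-⊆ : {x : Fin n} {p q : Subset n} → x ∈ q → p ⊆ q → ⁅ x ⁆ ∪ p ⊆ q
⁅x⁆∪-⊆ {x = x} {p} x∈q p⊆q y∈ with x∈p∪q⁻ ⁅ x ⁆ p y∈
... | inj₁ y∈⁅x⁆ with refl ← x∈⁅y⁆⇒x≡y x y∈⁅x⁆ = x∈q
... | inj₂ y∈p   = p⊆q y∈p

-- Free product independence on pairs of subsets

module _ (M : Matroid n) (N : Matroid m) where

  private
    module M = Matroid M
    module N = Matroid N

  -- k ≤ rank M + rank_N B; witnesses A′ and B′ not required to be bases avoid the rank functions.
  record Spans (k : ℕ) (B : Subset m) : Set where
    constructor spans
    field
      {A′}    : Subset n
      {B′}    : Subset m
      A′-ind  : M.Indep A′
      B′-ind  : N.Indep B′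
      B′⊆B    : B′ ⊆ B
      bound   : k ≤ ∣ A′ ∣ + ∣ B′ ∣

  Free : Subset n → Subset m → Set
  Free A B = M.Indep A × Spans (∣ A ∣ + ∣ B ∣) B

  spans? : ∀ k B → Dec (Spans k B)
  spans? k B = map′
    (λ (A′ , B′ , p , q , r , s) → spans p q (λ {x} → r {x}) s)
    (λ (spans p q r s) → _ , _ , p , q , (λ {x} → r {x}) , s)
    (anySubset? λ A′ → anySubset? (witness? A′))
    where
    witness? : ∀ A′ B′ → Dec (M.Indep A′ × N.Indep B′ × B′ ⊆ B × k ≤ ∣ A′ ∣ + ∣ B′ ∣)
    witness? A′ B′ = M.indep? A′ ×-dec N.indep? B′ ×-dec B′ ⊆? B ×-dec k ≤? (∣ A′ ∣ + ∣ B′ ∣)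

  spans-mono : ∀ {k l B D} → l ≤ k → B ⊆ D → Spans k B → Spans l D
  spans-mono l≤k B⊆D (spans p q B′⊆B k≤) = spans p q (⊆-trans B′⊆B B⊆D) (≤-trans l≤k k≤)

  -- The two sets serve as their own witnesses, so the free product has at least the independent
  -- sets of the direct sum.
  free-× : ∀ {A B} → M.Indep A → N.Indep B → Free A B
  free-× a b = a , spans a b ⊆-refl ≤-refl

  free-empty : Free ⊥ ⊥
  free-empty = free-× M.empty N.empty

  -- Cutting the witness `B′` down to `B′ ∩ D` costs at most as much as shrinking `B` to `D`, since
  -- `B′ ∪ D` still lies in `B`. Adding `∣ B′ ∣` to both sides of the bound turns this into
  -- inclusion-exclusion without subtraction.
  free-hereditary : ∀ {A B C D} → C ⊆ A → D ⊆ B → Free A B → Free C D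
  free-hereditary {A} {B} {C} {D} C⊆A D⊆B (a , spans {A′} {B′} p q B′⊆B k≤) =
    M.hereditary _ _ C⊆A a ,
    spans p (N.hereditary _ _ (p∩q⊆p B′ D) q) (p∩q⊆q B′ D) (+-cancelˡ-≤ ∣ B′ ∣ _ _ bound)
    where
    open ≤-Reasoning
    bound : ∣ B′ ∣ + (∣ C ∣ + ∣ D ∣) ≤ ∣ B′ ∣ + (∣ A′ ∣ + ∣ B′ ∩ D ∣)
    bound = begin
      ∣ B′ ∣ + (∣ C ∣ + ∣ D ∣)          ≡⟨ x∙yz≈y∙xz (∣ B′ ∣) (∣ C ∣) _ ⟩
      ∣ C ∣ + (∣ B′ ∣ + ∣ D ∣)          ≡⟨ cong (∣ C ∣ +_) (∣p∣+∣q∣≡∣p∪q∣+∣p∩q∣ B′ D) ⟩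
      ∣ C ∣ + (∣ B′ ∪ D ∣ + ∣ B′ ∩ D ∣) ≤⟨ +-mono-≤ (p⊆q⇒∣p∣≤∣q∣ C⊆A)
                                            (+-monoˡ-≤ _ (p⊆q⇒∣p∣≤∣q∣ ∪⊆B)) ⟩
      ∣ A ∣ + (∣ B ∣ + ∣ B′ ∩ D ∣)      ≡⟨ +-assoc (∣ A ∣) (∣ B ∣) _ ⟨
      ∣ A ∣ + ∣ B ∣ + ∣ B′ ∩ D ∣        ≤⟨ +-monoˡ-≤ _ k≤ ⟩
      ∣ A′ ∣ + ∣ B′ ∣ + ∣ B′ ∩ D ∣      ≡⟨ xy∙z≈y∙xz (∣ A′ ∣) (∣ B′ ∣) _ ⟩
      ∣ B′ ∣ + (∣ A′ ∣ + ∣ B′ ∩ D ∣)    ∎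
      where
      open import Algebra.Properties.CommutativeSemigroup +-commutativeSemigroup
        using (x∙yz≈y∙xz; xy∙z≈y∙xz)
      ∪⊆B : B′ ∪ D ⊆ B
      ∪⊆B y∈ with x∈p∪q⁻ B′ D y∈
      ... | inj₁ y∈B′ = B′⊆B y∈B′
      ... | inj₂ y∈D  = D⊆B y∈D

  Extension : (A C : Subset n) (B D : Subset m) → Set
  Extension A C B D =
    (∃[ x ] (x ∈ C × x ∉ A × Free (⁅ x ⁆ ∪ A) B)) ⊎ (∃[ y ] (y ∈ D × y ∉ B × Free A (⁅ y ⁆ ∪ B)))

  extendʳ : ∀ {A B y} → M.Indep A → y ∉ B → Spans (suc (∣ A ∣ + ∣ B ∣)) (⁅ y ⁆ ∪ B) → Free A (⁅ y ⁆ ∪ B)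
  extendʳ {A} {B} a y∉B s = a , spans-mono (≤-reflexive
    (trans (cong (∣ A ∣ +_) (∣⁅x⁆∪p∣≡1+∣p∣ y∉B)) (+-suc ∣ A ∣ ∣ B ∣))) ⊆-refl s

  -- If the rank bound is strict for A ⊔ B, then any element is addable that keeps the left part
  -- independent in M.
  extend-slack : ∀ {A B C D} → M.Indep A → M.Indep C → ∣ A ∣ + ∣ B ∣ < ∣ C ∣ + ∣ D ∣ →
                 Spans (suc (∣ A ∣ + ∣ B ∣)) B → Extension A C B D
  extend-slack {A} {B} {C} {D} a c lt s with +-<-split lt
  ... | inj₁ A<C with x , x∈C , x∉A , p ← M.augmentation A C a c A<C =
    inj₁ (x , x∈C , x∉A , p , spans-mono (≤-reflexive (cong (_+ ∣ B ∣) (∣⁅x⁆∪p∣≡1+∣p∣ x∉A))) ⊆-refl s)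
  ... | inj₂ B<D with y , y∈D , y∉B ← ∣p∣<∣q∣⇒∃∈q∉p B D B<D =
    inj₂ (y , y∈D , y∉B , extendʳ a y∉B (spans-mono ≤-refl (q⊆p∪q ⁅ y ⁆ B) s))

  -- With a tight bound for A ⊔ B, the witnesses of C ⊔ D are larger, so those of A ⊔ B can be
  -- enlarged: either they become slack, or the element gained by augmentation in N lies outside B.
  free-augmentation : ∀ {A B C D} → Free A B → Free C D → ∣ A ∣ + ∣ B ∣ < ∣ C ∣ + ∣ D ∣ → Extension A C B D
  free-augmentation {A} {B} {C} {D} (a , spans {A′} {B′} a′ b′ B′⊆B AB≤) (c , spans {C′} {D′} c′ d′ D′⊆D CD≤) lt
    with +-<-split {∣ A′ ∣} {∣ B′ ∣} {∣ C′ ∣} {∣ D′ ∣} | (∣ A ∣ + ∣ B ∣) <? (∣ A′ ∣ + ∣ B′ ∣)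
  ... | _     | yes lt′ = extend-slack a c lt (spans a′ b′ B′⊆B lt′)
  ... | split | no  ≮
    with split (≤-<-trans (≮⇒≥ ≮) (<-≤-trans lt CD≤))
  ... | inj₁ A′<C′ = extend-slack a c lt (spans c′ b′ B′⊆B (≤-<-trans AB≤ (+-monoˡ-< ∣ B′ ∣ A′<C′)))
  ... | inj₂ B′<D′ with N.augmentation B′ D′ b′ d′ B′<D′
  ... | y , y∈D′ , y∉B′ , r with y ∈? B | suc∣A∣+∣B∣≤
    where
    suc∣A∣+∣B∣≤ : suc (∣ A ∣ + ∣ B ∣) ≤ ∣ A′ ∣ + ∣ ⁅ y ⁆ ∪ B′ ∣
    suc∣A∣+∣B∣≤ = ≤-trans (s≤s AB≤) (≤-reflexive (sym
      (trans (cong (∣ A′ ∣ +_) (∣⁅x⁆∪p∣≡1+∣p∣ y∉B′)) (+-suc ∣ A′ ∣ ∣ B′ ∣))))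
  ... | yes y∈B | bound = extend-slack a c lt (spans a′ r (⁅x⁆∪-⊆ y∈B B′⊆B) bound)
  ... | no  y∉B | bound = inj₂ (y , D′⊆D y∈D′ , y∉B ,
    extendʳ a y∉B (spans a′ r (⁅x⁆∪-⊆ (x∈p∪q⁺ (inj₁ (x∈⁅x⁆ y))) (⊆-trans B′⊆B (q⊆p∪q ⁅ y ⁆ B))) bound))

  -- The total size is unchanged, the left part only shrinks, and the right part only grows, so the
  -- old witnesses still span. This asymmetry between the blocks drives the whole cancellation
  -- argument.
  free-exchange : ∀ {A B x y} → x ∈ A → y ∉ B → Free A B → Free (A [ x ]≔ outside) (B [ y ]≔ inside)
  free-exchange {A} {B} {x} {y} x∈A y∉B (a , s) =
    M.hereditary _ _ (p[x]≔outside⊆p x A) a ,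
    subst (λ D → Spans (∣ A [ x ]≔ outside ∣ + ∣ D ∣) D) (⁅x⁆∪p≡p[x]≔inside y B)
      (spans-mono (≤-reflexive same-size) (q⊆p∪q ⁅ y ⁆ B) s)
    where
    same-size : ∣ A [ x ]≔ outside ∣ + ∣ ⁅ y ⁆ ∪ B ∣ ≡ ∣ A ∣ + ∣ B ∣
    same-size = trans (cong (∣ A [ x ]≔ outside ∣ +_) (∣⁅x⁆∪p∣≡1+∣p∣ y∉B))
      (trans (+-suc _ ∣ B ∣) (cong (_+ ∣ B ∣) (sym (∣p∣≡1+∣p[x]≔outside∣ x∈A))))

  -- For A a basis of M, independence of A ⊔ B forces B to be independent; the recursion climbs to a
  -- basis through the witnesses A′.
  right-indep : ∀ {B} → (∀ A → M.Indep A → Free A B) → N.Indep B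
  right-indep {B} free = climb n ⊥ (m≤n+m n _) M.empty
    where
    -- The fuel `k` bounds how much `A` can still grow: every round replaces `A` by a strictly
    -- larger `A′`, and no subset has more than `n` elements.
    climb : ∀ k A → n ≤ ∣ A ∣ + k → M.Indep A → N.Indep B
    climb k A n≤ a with free A a
    ... | _ , spans {A′} {B′} a′ b′ B′⊆B AB≤ with +-≤-split AB≤
    ... | inj₂ B≤B′ = N.hereditary B′ B (p⊆q∧∣q∣≤∣p∣⇒q⊆p B′⊆B B≤B′) b′
    climb zero    A n≤ a | _ , spans {A′} a′ _ _ _ | inj₁ A<A′ =
      contradiction (≤-trans A<A′ (∣p∣≤n A′)) (≤⇒≯ (subst (n ≤_) (+-identityʳ ∣ A ∣) n≤))
    climb (suc k) A n≤ a | _ , spans {A′} a′ _ _ _ | inj₁ A<A′ =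
      climb k A′ (≤-trans n≤ (≤-trans (≤-reflexive (+-suc ∣ A ∣ k)) (+-monoˡ-≤ k A<A′))) a′

-- Subsets of a disjoint union as concatenated vectors

-- A view: matching on it turns an arbitrary subset into a literal concatenation, to which the
-- lemmas on `++` apply.
data Blocks (n : ℕ) {m : ℕ} : Subset (n + m) → Set where
  _⧺_ : (A : Subset n) (B : Subset m) → Blocks n (A ++ B)

blocks : ∀ n (I : Subset (n + m)) → Blocks n I
blocks n I = subst (Blocks n) (take++drop≡id n I) (take n I ⧺ drop n I)

take-++ : (A : Subset n) (B : Subset m) → take n (A ++ B) ≡ A
take-++ {n} A B = proj₁ (++-injective (take n (A ++ B)) A (take++drop≡id n (A ++ B)))

drop-++ : (A : Subset n) (B : Subset m) → drop n (A ++ B) ≡ B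
drop-++ {n} A B = proj₂ (++-injective (take n (A ++ B)) A (take++drop≡id n (A ++ B)))

⊥++⊥ : ∀ n → ⊥ {n} ++ ⊥ {m} ≡ ⊥
⊥++⊥ zero    = refl
⊥++⊥ (suc n) = cong (outside ∷_) (⊥++⊥ n)

∣p++q∣ : (p : Subset n) (q : Subset m) → ∣ p ++ q ∣ ≡ ∣ p ∣ + ∣ q ∣
∣p++q∣ []            q = refl
∣p++q∣ (inside  ∷ p) q = cong suc (∣p++q∣ p q)
∣p++q∣ (outside ∷ p) q = ∣p++q∣ p q

module _ (p : Subset n) (q : Subset m) where
  ∈-++⁺ˡ : ∀ {x} → x ∈ p → x ↑ˡ m ∈ p ++ q
  ∈-++⁺ˡ {x} x∈p = lookup⇒[]= _ _ (trans (lookup-++ˡ p q x) ([]=⇒lookup x∈p))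

  ∈-++⁻ˡ : ∀ {x} → x ↑ˡ m ∈ p ++ q → x ∈ p
  ∈-++⁻ˡ {x} x∈ = lookup⇒[]= _ _ (trans (sym (lookup-++ˡ p q x)) ([]=⇒lookup x∈))

  ∈-++⁺ʳ : ∀ {x} → x ∈ q → n ↑ʳ x ∈ p ++ q
  ∈-++⁺ʳ {x} x∈q = lookup⇒[]= _ _ (trans (lookup-++ʳ p q x) ([]=⇒lookup x∈q))

  ∈-++⁻ʳ : ∀ {x} → n ↑ʳ x ∈ p ++ q → x ∈ q
  ∈-++⁻ʳ {x} x∈ = lookup⇒[]= _ _ (trans (sym (lookup-++ʳ p q x)) ([]=⇒lookup x∈))

  ⁅x↑ˡ⁆∪ : ∀ x → ⁅ x ↑ˡ m ⁆ ∪ (p ++ q) ≡ (⁅ x ⁆ ∪ p) ++ q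
  ⁅x↑ˡ⁆∪ x = trans (⁅x⁆∪p≡p[x]≔inside (x ↑ˡ m) (p ++ q))
    (trans ([]≔-++-↑ˡ p q x) (cong (_++ q) (sym (⁅x⁆∪p≡p[x]≔inside x p))))

  ⁅x↑ʳ⁆∪ : ∀ x → ⁅ n ↑ʳ x ⁆ ∪ (p ++ q) ≡ p ++ (⁅ x ⁆ ∪ q)
  ⁅x↑ʳ⁆∪ x = trans (⁅x⁆∪p≡p[x]≔inside (n ↑ʳ x) (p ++ q))
    (trans ([]≔-++-↑ʳ p q x) (cong (p ++_) (sym (⁅x⁆∪p≡p[x]≔inside x q))))

-- The free product as a matroid

module _ (M : Matroid n) (N : Matroid m) where

  FreeInd : Subset (n + m) → Set
  FreeInd I = Free M N (take n I) (drop n I)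

  freeInd⁺ : ∀ A B → Free M N A B → FreeInd (A ++ B)
  freeInd⁺ A B p rewrite take-++ A B | drop-++ A B = p

  freeInd⁻ : ∀ A B → FreeInd (A ++ B) → Free M N A B
  freeInd⁻ A B p rewrite take-++ A B | drop-++ A B = p

  freeInd-empty : FreeInd ⊥
  freeInd-empty = subst FreeInd (⊥++⊥ n) (freeInd⁺ ⊥ ⊥ (free-empty M N))

  freeInd-hereditary : ∀ I J → J ⊆ I → FreeInd I → FreeInd J
  freeInd-hereditary I J J⊆I p with blocks n I | blocks n J
  ... | A ⧺ B | C ⧺ D = freeInd⁺ C D (free-hereditary M N
    (λ x∈C → ∈-++⁻ˡ A B (J⊆I (∈-++⁺ˡ C D x∈C)))
    (λ x∈D → ∈-++⁻ʳ A B (J⊆I (∈-++⁺ʳ C D x∈D)))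
    (freeInd⁻ A B p))

  freeInd-augmentation : ∀ I J → FreeInd I → FreeInd J → ∣ I ∣ < ∣ J ∣ →
                         ∃[ x ] (x ∈ J × x ∉ I × FreeInd (⁅ x ⁆ ∪ I))
  freeInd-augmentation I J p q I<J with blocks n I | blocks n J
  ... | A ⧺ B | C ⧺ D
    with free-augmentation M N (freeInd⁻ A B p) (freeInd⁻ C D q) (subst₂ _<_ (∣p++q∣ A B) (∣p++q∣ C D) I<J)
  ... | inj₁ (x , x∈C , x∉A , r) = x ↑ˡ m , ∈-++⁺ˡ C D x∈C , x∉A ∘ ∈-++⁻ˡ A B ,
    subst FreeInd (sym (⁅x↑ˡ⁆∪ A B x)) (freeInd⁺ (⁅ x ⁆ ∪ A) B r)
  ... | inj₂ (y , y∈D , y∉B , r) = n ↑ʳ y , ∈-++⁺ʳ C D y∈D , y∉B ∘ ∈-++⁻ʳ A B ,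
    subst FreeInd (sym (⁅x↑ʳ⁆∪ A B y)) (freeInd⁺ A (⁅ y ⁆ ∪ B) r)

  infixr 5 _□_

  _□_ : Matroid (n + m)
  _□_ = record
    { Indep     = FreeInd
    ; indep?    = λ I → indep? M (take n I) ×-dec spans? M N (∣ take n I ∣ + ∣ drop n I ∣) (drop n I)
    ; isMatroid = record
      { empty        = freeInd-empty
      ; hereditary   = freeInd-hereditary
      ; augmentation = freeInd-augmentation
      }
    }

  -- The form of `free-exchange` that fits `image-transpose`: membership is given by `lookup` and
  -- the exchange by two updates.
  □-exchange : ∀ I i j → lookup I (i ↑ˡ m) ≡ inside → lookup I (n ↑ʳ j) ≡ outside →
               FreeInd I → FreeInd ((I [ i ↑ˡ m ]≔ outside) [ n ↑ʳ j ]≔ inside)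
  □-exchange I i j i∈I j∉I p with blocks n I
  ... | A ⧺ B = subst FreeInd
    (sym (trans (cong (_[ n ↑ʳ j ]≔ inside) ([]≔-++-↑ˡ A B i)) ([]≔-++-↑ʳ (A [ i ]≔ outside) B j)))
    (freeInd⁺ _ _ (free-exchange M N
      (lookup⇒[]= i A (trans (sym (lookup-++ˡ A B i)) i∈I))
      (λ j∈B → contradiction (trans (sym ([]=⇒lookup j∈B)) (trans (sym (lookup-++ʳ A B j)) j∉I)) λ ())
      (freeInd⁻ A B p)))

-- Images of subsets and transpositions

-- `image` is defined through the inverse of `π`; this criterion compares along `π` itself, which
-- keeps inverses out of later computations.
image-unique : (π : Permutation m n) (I : Subset m) (J : Subset n) →
               (∀ x → lookup J (π ⟨$⟩ʳ x) ≡ lookup I x) → image π I ≡ J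
image-unique π I J h = trans
  (tabulate-cong λ j → trans (sym (h (π ⟨$⟩ˡ j))) (cong (lookup J) (inverseʳ π)))
  (tabulate∘lookup J)

lookup-image : (π : Permutation m n) (I : Subset m) (x : Fin m) →
               lookup (image π I) (π ⟨$⟩ʳ x) ≡ lookup I x
lookup-image π I x = trans (lookup∘tabulate _ (π ⟨$⟩ʳ x)) (cong (lookup I) (inverseˡ π))

image-flip : (π : Permutation m n) (J : Subset n) → image π (image (flip π) J) ≡ J
image-flip π J = image-unique π (image (flip π) J) J λ x → sym (lookup∘tabulate (lookup J ∘ (π ⟨$⟩ʳ_)) x)

image-[]≔ : (π : Permutation m n) (I : Subset m) (x : Fin m) {b : Side} →
            image π (I [ x ]≔ b) ≡ image π I [ π ⟨$⟩ʳ x ]≔ b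
image-[]≔ π I x {b} = image-unique π (I [ x ]≔ b) _ lookup-[]≔
  where
  lookup-[]≔ : ∀ y → lookup (image π I [ π ⟨$⟩ʳ x ]≔ b) (π ⟨$⟩ʳ y) ≡ lookup (I [ x ]≔ b) y
  lookup-[]≔ y with y ≟ᶠ x
  ... | yes refl = trans (lookup∘update (π ⟨$⟩ʳ x) (image π I) b) (sym (lookup∘update x I b))
  ... | no  y≢x  = trans (lookup∘update′ (y≢x ∘ ⟨$⟩ʳ-injective π) (image π I) b)
    (trans (lookup-image π I y) (sym (lookup∘update′ y≢x I b)))

image-transpose : (x y : Fin n) (I : Subset n) →
                  image (transpose x y) I ≡ (I [ x ]≔ lookup I y) [ y ]≔ lookup I x
image-transpose x y I = trans (tabulate-cong pointwise) (tabulate∘lookup _)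
  where
  pointwise : ∀ z → lookup I (PC.transpose y x z) ≡
                    lookup ((I [ x ]≔ lookup I y) [ y ]≔ lookup I x) z
  pointwise z with z ≟ᶠ y
  ... | yes refl = sym (lookup∘update z (I [ x ]≔ lookup I z) _)
  ... | no  z≢y  with z ≟ᶠ x
  ...   | yes refl = sym (trans (lookup∘update′ z≢y (I [ z ]≔ lookup I y) _) (lookup∘update z I _))
  ...   | no  z≢x  = sym (trans (lookup∘update′ z≢y (I [ x ]≔ lookup I y) _) (lookup∘update′ z≢x I _))

transpose-fixes : {x y z : Fin n} → z ≢ x → z ≢ y → PC.transpose x y z ≡ z
transpose-fixes {x = x} {y} {z} z≢x z≢y with z ≟ᶠ x
... | yes z≡x = contradiction z≡x z≢x
... | no  _ with z ≟ᶠ y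
...   | yes z≡y = contradiction z≡y z≢y
...   | no  _   = refl

transpose-mapsˡ : (x y : Fin n) → PC.transpose x y x ≡ y
transpose-mapsˡ x y with x ≟ᶠ x
... | yes _   = refl
... | no  x≢x = contradiction refl x≢x

transpose-mapsʳ : (x y : Fin n) → PC.transpose x y y ≡ x
transpose-mapsʳ x y with y ≟ᶠ x
... | yes y≡x = y≡x
... | no  _ with y ≟ᶠ y
...   | yes _   = refl
...   | no  y≢y = contradiction refl y≢y

-- The inverse of `transpose x y` is given by `PC.transpose y x`, so this makes a transposition its
-- own inverse, as `image-transpose-involutive` requires.
transpose-comm : (x y z : Fin n) → PC.transpose x y z ≡ PC.transpose y x z
transpose-comm x y z = cases (z ≟ᶠ x) (z ≟ᶠ y)
  where
  cases : Dec (z ≡ x) → Dec (z ≡ y) → PC.transpose x y z ≡ PC.transpose y x z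
  cases (yes refl) _          = trans (transpose-mapsˡ x y) (sym (transpose-mapsʳ y x))
  cases (no  _)    (yes refl) = trans (transpose-mapsʳ x y) (sym (transpose-mapsˡ y x))
  cases (no  z≢x)  (no  z≢y)  = trans (transpose-fixes z≢x z≢y) (sym (transpose-fixes z≢y z≢x))

image-transpose-involutive : (x y : Fin n) (I : Subset n) →
                             image (transpose x y) (image (transpose x y) I) ≡ I
image-transpose-involutive x y I = trans
  (cong (image (transpose x y)) (tabulate-cong λ z → cong (lookup I) (transpose-comm y x z)))
  (image-flip (transpose x y) I)

-- Blocks and block-preserving permutations

Left : ∀ n {m} → Fin (n + m) → Set
Left n {m} x = ∃[ i ] x ≡ i ↑ˡ m

Right : ∀ n {m} → Fin (n + m) → Set
Right n {m} x = ∃[ j ] x ≡ n ↑ʳ j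

side : ∀ n {m} (x : Fin (n + m)) → Left n {m} x ⊎ Right n x
side n {m} x with splitAt n x | join-splitAt n m x
... | inj₁ i | eq = inj₁ (i , sym eq)
... | inj₂ j | eq = inj₂ (j , sym eq)

left≢right : (i : Fin n) (j : Fin m) → i ↑ˡ m ≢ n ↑ʳ j
left≢right {n} {m} i j eq
  with () ← trans (sym (splitAt-↑ˡ n i m)) (trans (cong (splitAt n) eq) (splitAt-↑ʳ n m j))

-- Pigeonhole: if `j` were missed, punching it out would inject `Fin (suc n)` into `Fin n`.
injective⇒surjective : (g : Fin n → Fin n) → (∀ {i j} → g i ≡ g j → i ≡ j) → ∀ j → ∃[ i ] g i ≡ j
injective⇒surjective {suc n} g g-inj j with any? (λ i → g i ≟ᶠ j)
... | yes found = found
... | no  none  = contradiction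
  (injective⇒≤ {f = λ i → punchOut (≢g i)} (g-inj ∘ punchOut-injective (≢g _) (≢g _))) (<-irrefl refl)
  where
  ≢g : ∀ i → j ≢ g i
  ≢g i eq = none (i , sym eq)

-- The map induced on the left block is injective, hence surjective, so each left point already has
-- its preimage on the left.
left-preserving⁻¹ : (π : Permutation (n + m) (n + m)) → (∀ i → Left n (π ⟨$⟩ʳ (i ↑ˡ m))) →
                    ∀ i → Left n (π ⟨$⟩ˡ (i ↑ˡ m))
left-preserving⁻¹ {n} {m} π left i with injective⇒surjective (proj₁ ∘ left) injective i
  where
  injective : ∀ {i j} → proj₁ (left i) ≡ proj₁ (left j) → i ≡ j
  injective {i} {j} eq = ↑ˡ-injective m i j (⟨$⟩ʳ-injective π
    (trans (proj₂ (left i)) (trans (cong (_↑ˡ m) eq) (sym (proj₂ (left j))))))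
... | k , refl = k , trans (cong (π ⟨$⟩ˡ_) (sym (proj₂ (left k)))) (inverseˡ π)

-- Serves both block inclusions. Preservation is required in both directions because the inverse
-- must restrict as well.
restrict : ∀ {k l} (e : Fin k → Fin l) → (∀ {i j} → e i ≡ e j → i ≡ j) → (π : Permutation l l) →
           (∀ i → ∃[ j ] π ⟨$⟩ʳ (e i) ≡ e j) → (∀ i → ∃[ j ] π ⟨$⟩ˡ (e i) ≡ e j) →
           Σ[ σ ∈ Permutation k k ] (∀ i → π ⟨$⟩ʳ (e i) ≡ e (σ ⟨$⟩ʳ i))
restrict e e-inj π fwd bwd = permutation (proj₁ ∘ fwd) (proj₁ ∘ bwd)
  (λ i → e-inj (trans (sym (proj₂ (fwd _))) (trans (cong (π ⟨$⟩ʳ_) (sym (proj₂ (bwd i)))) (inverseʳ π))))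
  (λ i → e-inj (trans (sym (proj₂ (bwd _))) (trans (cong (π ⟨$⟩ˡ_) (sym (proj₂ (fwd i)))) (inverseˡ π))))
  , proj₂ ∘ fwd

-- Cancellation: the free product determines its factors

module _ (M P : Matroid n) (N Q : Matroid m) where

  -- If y ∈ I and x ∉ I, the exchange takes place in P □ Q, where π moves y to the left block and
  -- x to the right one.
  transpose-automorphism : ((π , _) : M □ N ≅ P □ Q) (i : Fin n) (j : Fin m) →
    Right n (π ⟨$⟩ʳ (i ↑ˡ m)) → Left n (π ⟨$⟩ʳ (n ↑ʳ j)) → M □ N ≅ M □ N
  transpose-automorphism (π , h) i j (j′ , πx≡) (i′ , πy≡) = transpose x y , λ I → mk⇔
    (preserves I)
    (λ p → subst (FreeInd M N) (image-transpose-involutive x y I) (preserves _ p))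
    where
    x y : Fin (n + m)
    x = i ↑ˡ m
    y = n ↑ʳ j

    x≢y : x ≢ y
    x≢y = left≢right i j

    unchanged : ∀ I {b} → lookup I x ≡ b → lookup I y ≡ b → (I [ x ]≔ b) [ y ]≔ b ≡ I
    unchanged I refl Iy = trans
      (cong₂ (λ J b → J [ y ]≔ b) ([]≔-lookup I x) (sym Iy))
      ([]≔-lookup I y)

    preserves : ∀ I → FreeInd M N I → FreeInd M N (image (transpose x y) I)
    preserves I p with lookup I x in Ix | lookup I y in Iy | image-transpose x y I
    ... | inside  | outside | eq = subst (FreeInd M N) (sym eq) (□-exchange M N I i j Ix Iy p)
    ... | inside  | inside  | eq = subst (FreeInd M N) (sym (trans eq (unchanged I Ix Iy))) p
    ... | outside | outside | eq = subst (FreeInd M N) (sym (trans eq (unchanged I Ix Iy))) p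
    ... | outside | inside  | eq = subst (FreeInd M N) (sym eq) (from (h _)
      (subst (FreeInd P Q) (sym swapped) (□-exchange P Q (image π I) i′ j′
        (trans (cong (lookup (image π I)) (sym πy≡)) (trans (lookup-image π I y) Iy))
        (trans (cong (lookup (image π I)) (sym πx≡)) (trans (lookup-image π I x) Ix))
        (to (h I) p))))
      where
      open ≡-Reasoning
      swapped : image π ((I [ x ]≔ inside) [ y ]≔ outside) ≡
                (image π I [ i′ ↑ˡ m ]≔ outside) [ n ↑ʳ j′ ]≔ inside
      swapped = begin
        image π ((I [ x ]≔ inside) [ y ]≔ outside)
          ≡⟨ cong (image π) ([]≔-commutes I x y x≢y) ⟩
        image π ((I [ y ]≔ outside) [ x ]≔ inside)
          ≡⟨ image-[]≔ π (I [ y ]≔ outside) x ⟩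
        image π (I [ y ]≔ outside) [ π ⟨$⟩ʳ x ]≔ inside
          ≡⟨ cong (_[ π ⟨$⟩ʳ x ]≔ inside) (image-[]≔ π I y) ⟩
        (image π I [ π ⟨$⟩ʳ y ]≔ outside) [ π ⟨$⟩ʳ x ]≔ inside
          ≡⟨ cong₂ (λ u v → (image π I [ u ]≔ outside) [ v ]≔ inside) πy≡ πx≡ ⟩
        (image π I [ i′ ↑ˡ m ]≔ outside) [ n ↑ʳ j′ ]≔ inside ∎

  Aligned : ℕ → M □ N ≅ P □ Q → Set
  Aligned k (π , _) = ∀ i → toℕ i < k → Left n (π ⟨$⟩ʳ (i ↑ˡ m))

  -- Induction over the left points: if point number `k` is sent to the right, one transposition
  -- automorphism repairs it. That transposition moves only this point and a right point, so the
  -- points aligned earlier stay aligned.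
  align : M □ N ≅ P □ Q → ∀ k → k ≤ n → Σ[ iso ∈ M □ N ≅ P □ Q ] Aligned k iso
  align iso zero    _   = iso , λ _ ()
  align iso (suc k) k<n with align iso k (<⇒≤ k<n)
  ... | iso′@(π , _) , aligned with side n (π ⟨$⟩ʳ (fromℕ< k<n ↑ˡ m))
  ... | inj₁ left  = iso′ , aligned′
    where
    aligned′ : Aligned (suc k) iso′
    aligned′ i i<1+k with m<1+n⇒m<n∨m≡n i<1+k
    ... | inj₁ i<k  = aligned i i<k
    ... | inj₂ refl = subst (λ i → Left n (π ⟨$⟩ʳ (i ↑ˡ m))) (fromℕ<-toℕ i k<n) left
  ... | inj₂ right with any? (λ i → any? λ j → π ⟨$⟩ˡ (i ↑ˡ m) ≟ᶠ n ↑ʳ j)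
  -- If every left point has its preimage on the left, the inverse of `π` preserves the left block.
  -- By pigeonhole so does `π`, against `right`.
  ... | no none  = contradiction (trans (sym (proj₂ left)) (proj₂ right)) (left≢right _ _)
    where
    leftˡ : ∀ i → Left n (π ⟨$⟩ˡ (i ↑ˡ m))
    leftˡ i with side n (π ⟨$⟩ˡ (i ↑ˡ m))
    ... | inj₁ l        = l
    ... | inj₂ (j , eq) = contradiction (i , j , eq) none

    left : Left n (π ⟨$⟩ʳ (fromℕ< k<n ↑ˡ m))
    left = left-preserving⁻¹ (flip π) leftˡ (fromℕ< k<n)
  ... | yes (i′ , j , eq) =
    ≅-trans {M = M □ N} {M □ N} {P □ Q} (transpose-automorphism iso′ i j right (i′ , πy≡)) iso′ , aligned′
    where
    i : Fin n
    i = fromℕ< k<n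

    πy≡ : π ⟨$⟩ʳ (n ↑ʳ j) ≡ i′ ↑ˡ m
    πy≡ = trans (cong (π ⟨$⟩ʳ_) (sym eq)) (inverseʳ π)

    aligned′ : ∀ l → toℕ l < suc k → Left n (π ⟨$⟩ʳ PC.transpose (i ↑ˡ m) (n ↑ʳ j) (l ↑ˡ m))
    aligned′ l l<1+k with m<1+n⇒m<n∨m≡n l<1+k
    ... | inj₂ refl = i′ , trans
      (cong (λ z → π ⟨$⟩ʳ PC.transpose (i ↑ˡ m) (n ↑ʳ j) (z ↑ˡ m)) (sym (fromℕ<-toℕ l k<n)))
      (trans (cong (π ⟨$⟩ʳ_) (transpose-mapsˡ (i ↑ˡ m) (n ↑ʳ j))) πy≡)
    ... | inj₁ l<k  = subst (λ z → Left n (π ⟨$⟩ʳ z)) (sym (transpose-fixes l≢i (left≢right l j))) (aligned l l<k)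
      where
      l≢i : l ↑ˡ m ≢ i ↑ˡ m
      l≢i eq = <⇒≢ l<k (trans (cong toℕ (↑ˡ-injective m l i eq)) (toℕ-fromℕ< k<n))

  record BlockIso : Set where
    field
      left   : Permutation n n
      right  : Permutation m m
      indep⇔ : ∀ A B → Free M N A B ⇔ Free P Q (image left A) (image right B)

  -- Full alignment makes `π` preserve the left block, and by pigeonhole its inverse does too. No
  -- point can then cross from right to left in either direction, so `π` splits into a permutation
  -- of each block.
  blockIso : M □ N ≅ P □ Q → BlockIso
  blockIso iso with align iso n ≤-refl
  ... | (π , h) , aligned = record { left = σ ; right = τ ; indep⇔ = λ A B → mk⇔
    (λ p → freeInd⁻ P Q _ _ (subst (FreeInd P Q) (image-++ A B) (to (h _) (freeInd⁺ M N A B p))))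
    (λ q → freeInd⁻ M N A B (from (h _) (subst (FreeInd P Q) (sym (image-++ A B)) (freeInd⁺ P Q _ _ q)))) }
    where
    leftʳ : ∀ i → Left n (π ⟨$⟩ʳ (i ↑ˡ m))
    leftʳ i = aligned i (toℕ<n i)

    leftˡ : ∀ i → Left n (π ⟨$⟩ˡ (i ↑ˡ m))
    leftˡ = left-preserving⁻¹ π leftʳ

    rightʳ : ∀ j → Right n (π ⟨$⟩ʳ (n ↑ʳ j))
    rightʳ j with side n (π ⟨$⟩ʳ (n ↑ʳ j))
    ... | inj₂ r        = r
    ... | inj₁ (i , eq) = contradiction
      (trans (sym (proj₂ (leftˡ i))) (trans (cong (π ⟨$⟩ˡ_) (sym eq)) (inverseˡ π))) (left≢right _ j)

    rightˡ : ∀ j → Right n (π ⟨$⟩ˡ (n ↑ʳ j))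
    rightˡ j with side n (π ⟨$⟩ˡ (n ↑ʳ j))
    ... | inj₂ r        = r
    ... | inj₁ (i , eq) = contradiction
      (trans (sym (proj₂ (leftʳ i))) (trans (cong (π ⟨$⟩ʳ_) (sym eq)) (inverseʳ π))) (left≢right _ j)

    onLeft : Σ[ σ ∈ Permutation n n ] (∀ i → π ⟨$⟩ʳ (i ↑ˡ m) ≡ (σ ⟨$⟩ʳ i) ↑ˡ m)
    onLeft = restrict (_↑ˡ m) (↑ˡ-injective m _ _) π leftʳ leftˡ

    onRight : Σ[ τ ∈ Permutation m m ] (∀ j → π ⟨$⟩ʳ (n ↑ʳ j) ≡ n ↑ʳ (τ ⟨$⟩ʳ j))
    onRight = restrict (n ↑ʳ_) (↑ʳ-injective n _ _) π rightʳ rightˡ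

    σ = proj₁ onLeft
    τ = proj₁ onRight

    image-++ : ∀ A B → image π (A ++ B) ≡ image σ A ++ image τ B
    image-++ A B = image-unique π (A ++ B) (image σ A ++ image τ B) λ x → pointwise (side n x)
      where
      pointwise : ∀ {x} → Left n x ⊎ Right n x →
                  lookup (image σ A ++ image τ B) (π ⟨$⟩ʳ x) ≡ lookup (A ++ B) x
      pointwise (inj₁ (i , refl)) = trans (cong (lookup (image σ A ++ image τ B)) (proj₂ onLeft i))
        (trans (lookup-++ˡ (image σ A) (image τ B) _) (trans (lookup-image σ A i) (sym (lookup-++ˡ A B i))))
      pointwise (inj₂ (j , refl)) = trans (cong (lookup (image σ A ++ image τ B)) (proj₂ onRight j))
        (trans (lookup-++ʳ (image σ A) (image τ B) _) (trans (lookup-image τ B j) (sym (lookup-++ʳ A B j))))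

  -- Independence in the left factor is read off by leaving the right part empty. For the right
  -- factor, a set independent in one matroid is free with every independent left part; this
  -- property transfers along the isomorphism, and `right-indep` recovers independence from it.
  □-cancel : M □ N ≅ P □ Q → M ≅ P × N ≅ Q
  □-cancel iso = (σ , λ A → mk⇔ (M⇒P A) (P⇒M A)) , (τ , λ B → mk⇔ (N⇒Q B) (Q⇒N B))
    where
    open BlockIso (blockIso iso) renaming (left to σ; right to τ)

    M⇒P : ∀ A → Indep M A → Indep P (image σ A)
    M⇒P A a = proj₁ (to (indep⇔ A ⊥) (free-× M N a (Matroid.empty N)))

    P⇒M : ∀ A → Indep P (image σ A) → Indep M A
    -- The pullback of `⊥` stands in for the empty set, so that `image-flip` alone identifies its
    -- image.
    P⇒M A p = proj₁ (from (indep⇔ A (image (flip τ) ⊥))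
      (subst (Free P Q (image σ A)) (sym (image-flip τ ⊥)) (free-× P Q p (Matroid.empty Q))))

    N⇒Q : ∀ B → Indep N B → Indep Q (image τ B)
    -- `right-indep` quantifies over independent sets of `P`; each is the image under `σ` of its
    -- pullback, which is independent in `M`.
    N⇒Q B b = right-indep P Q λ A p → subst (λ A → Free P Q A (image τ B)) (image-flip σ A)
      (to (indep⇔ (image (flip σ) A) B)
        (free-× M N (P⇒M _ (subst (Indep P) (sym (image-flip σ A)) p)) b))

    Q⇒N : ∀ B → Indep Q (image τ B) → Indep N B
    Q⇒N B q = right-indep M N λ A a → from (indep⇔ A B) (free-× P Q (M⇒P A a) q)

-- Counting isomorphism classes

-- Sending a pair of class indices to the class of the free product is injective by `□-cancel`.
-- Arbitrary bijections are taken as input, so only the fact that the numbers count classes enters,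
-- not how `f` is computed.
classes-* : ∀ {a b c} → Bijection (setoid (Fin a)) (≅-setoid n) → Bijection (setoid (Fin b)) (≅-setoid m) →
            Bijection (setoid (Fin c)) (≅-setoid (n + m)) → a * b ≤ c
classes-* {n} {m} {a} {b} {c} Ms Ns Ls = injective⇒≤ {f = classOf} classOf-injective
  where
  module Ms = Bijection Ms
  module Ns = Bijection Ns
  module Ls = Bijection Ls

  product : Fin a × Fin b → Matroid (n + m)
  product (i , j) = Ms.to i □ Ns.to j

  index : Matroid (n + m) → Fin c
  index L = proj₁ (Ls.surjective L)

  index-≅ : ∀ L → Ls.to (index L) ≅ L
  index-≅ L = proj₂ (Ls.surjective L) refl

  index-injective : ∀ K L → index K ≡ index L → K ≅ L
  index-injective K L eq = ≅-trans {M = K} {Ls.to (index K)} {L} (≅-sym {M = Ls.to (index K)} {K} (index-≅ K))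
    (subst (λ k → Ls.to k ≅ L) (sym eq) (index-≅ L))

  product-injective : ∀ p q → product p ≅ product q → p ≡ q
  product-injective (i , j) (i′ , j′) iso
    with M≅P , N≅Q ← □-cancel (Ms.to i) (Ms.to i′) (Ns.to j) (Ns.to j′) iso =
    cong₂ _,_ (Ms.injective M≅P) (Ns.injective N≅Q)

  classOf : Fin (a * b) → Fin c
  classOf k = index (product (remQuot {a} b k))

  classOf-injective : ∀ {k l} → classOf k ≡ classOf l → k ≡ l
  classOf-injective {k} {l} eq = trans (sym (combine-remQuot {a} b k)) (trans
    (cong (uncurry combine) (product-injective _ _
      (index-injective (product (remQuot {a} b k)) (product (remQuot {a} b l)) eq)))
    (combine-remQuot {a} b l))

corollary9 : (n m : ℕ) → f (n + m) ≥ f n * f m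
corollary9 n m = classes-* (f-counts-classes n) (f-counts-classes m) (f-counts-classes (n + m))
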